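{- Let $\mathsf{L}_1$ and $\mathsf{L}_2$ be two HTC-logics such that each $\mathsf{L}_i$ is valid in at least one normal neighborhood frame (i.e. $nV(\mathsf{L}_1)\neq\varnothing$ and $nV(\mathsf{L}_2)\ne\varnothing$). Then $$\mathsf{L}_1 \times_n \mathsf{L}_2 = \langle \mathsf{L}_1, \mathsf{L}_2\rangle .$$
   Context: Modal formulas are built from propositional letters, $\bot$, $\to$ and modal operators $\Box_i$ ($\Box$ if there is one modality); $\Diamond_i=\lnot\Box_i\lnot$. A (normal modal) logic is a set of formulas containing all classical tautologies and $\Box_i(p\to q)\to(\Box_i p\to\Box_i q)$, closed under substitution, modus ponens and $A/\Box_i A$. $\mathsf{K}_n$ is the minimal one with $n$ modalities, and $\mathsf{L}+\Gamma$ is the minimal logic containing $\mathsf{L}\cup\Gamma$. A formula is closed if it contains no propositional letters. HTC-logic: a unimodal logic axiomatizable (over $\mathsf{K}_1$) by closed formulas and formulas of the form $\Box p\to\Box^n p$, $n\ge 0$ (any set of such formulas). Fusion: for unimodal $\mathsf{L}_1,\mathsf{L}_2$, $\mathsf{L}_1*\mathsf{L}_2=\mathsf{K}_2+\mathsf{L}_1'+\mathsf{L}_2'$, where $\mathsf{L}_i'$ is $\mathsf{L}_i$ with every $\Box$ replaced by $\Box_i$. Let $\Delta=\{B\to\Box_2B : B \text{ closed and } \Box_2\text{ -free}\}\cup\{B\to\Box_1B: B\text{ closed and }\Box_1\text{ -free}\}$ and $\langle \mathsf{L}_1,\mathsf{L}_2\rangle=\mathsf{L}_1*\mathsf{L}_2+\Delta$.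 A filter on $X$ is a family of subsets of $X$ containing $X$, closed under binary intersections and supersets (the empty set is allowed to belong to it). A (normal) neighborhood frame (n-frame) is $(X,\tau)$ with $X\neq\varnothing$ and $\tau(x)$ a filter on $X$ for each $x\in X$; an n-2-frame $(X,\tau_1,\tau_2)$ has two such functions. For a valuation $\theta$ of letters by subsets of $X$, truth is defined as usual for Boolean connectives, and $x\models\Box_iA$ iff there is $U\in\tau_i(x)$ with $y\models A$ for all $y\in U$. A formula is valid in a frame if it is true at all points under all valuations. $\mathrm{Log}(\mathcal C)$ is the set of formulas valid in all frames of $\mathcal C$; $nV(\mathsf{L})$ is the class of n-frames validating all formulas of $\mathsf{L}$. Product of n-frames: $(X_1,\tau_1)\times(X_2,\tau_2)=(X_1\times X_2,\tau_1^h,\tau_2^v)$, where $\tau_1^h(x_1,x_2)=\{U\subseteq X_1\times X_2: \exists V\in\tau_1(x_1)\ V\times\{x_2\}\subseteq U\}$ and $\tau_2^v(x_1,x_2)=\{U\subseteq X_1\times X_2:\exists V\in\tau_2(x_2)\ \{x_1\}\times V\subseteq U\}$. For unimodal logics with $nV(\mathsf{L}_1),nV(\mathsf{L}_2)\neq\varnothing$, $\mathsf{L}_1\times_n\mathsf{L}_2=\mathrm{Log}(\{\mathfrak X_1\times\mathfrak X_2:\mathfrak X_1\in nV(\mathsf{L}_1),\ \mathfrak X_2\in nV(\mathsf{L}_2)\})$. -}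

module Defs where

open import Data.Bool.Base using (Bool; true; false; not; _∨_)
open import Data.Empty using (⊥)
open import Data.Fin.Base using (Fin; zero; suc)
open import Data.Nat.Base using (ℕ; zero; suc)
open import Data.Product.Base using (Σ; ∃; _×_; _,_)
open import Data.Unit.Base using (⊤)
open import Level using (Level; Lift; 0ℓ) renaming (suc to lsuc)
open import Relation.Binary.PropositionalEquality using (_≡_; _≢_)
open import Relation.Unary
  using (Pred; _∈_; _⊆_; _≐_; _∩_; _∪_; _⟨×⟩_; ｛_｝; ∅)
open import Relation.Unary.Polymorphic using (U)

private
  variable
    n : ℕ
    a b ℓ : Level

------------------------------------------------------------------------
-- Formulas with n modalities

infixr 6 _⇒_

data Form (n : ℕ) : Set where
  var : ℕ → Form n
  ⊥ᶠ  : Form n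
  _⇒_ : Form n → Form n → Form n
  □   : Fin n → Form n → Form n

□^ : ℕ → Form 1 → Form 1
□^ zero    A = A
□^ (suc k) A = □ zero (□^ k A)

Closed : Form n → Set
Closed (var p) = ⊥
Closed ⊥ᶠ      = ⊤
Closed (A ⇒ B) = Closed A × Closed B
Closed (□ i A) = Closed A

□-Free : Fin n → Form n → Set
□-Free i (var p) = ⊤
□-Free i ⊥ᶠ      = ⊤
□-Free i (A ⇒ B) = □-Free i A × □-Free i B
□-Free i (□ j A) = i ≢ j × □-Free i A

subst : (ℕ → Form n) → Form n → Form n
subst σ (var p) = σ p
subst σ ⊥ᶠ      = ⊥ᶠ
subst σ (A ⇒ B) = subst σ A ⇒ subst σ B
subst σ (□ i A) = □ i (subst σ A)

-- Boxed formulas are treated as propositional atoms; only the values of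
-- v on letters and on boxed formulas matter.
eval : (Form n → Bool) → Form n → Bool
eval v (var p) = v (var p)
eval v ⊥ᶠ      = false
eval v (A ⇒ B) = not (eval v A) ∨ eval v B
eval v (□ i A) = v (□ i A)

Tautology : Form n → Set
Tautology {n} A = (v : Form n → Bool) → eval v A ≡ true

------------------------------------------------------------------------
-- Normal modal logics

record IsLogic {n} (L : Pred (Form n) a) : Set a where
  field
    taut : ∀ {A} → Tautology A → A ∈ L
    K-ax : ∀ i p q → (□ i (var p ⇒ var q) ⇒ □ i (var p) ⇒ □ i (var q)) ∈ L
    sub  : ∀ σ {A} → A ∈ L → subst σ A ∈ L
    mp   : ∀ {A B} → (A ⇒ B) ∈ L → A ∈ L → B ∈ L
    nec  : ∀ i {A} → A ∈ L → □ i A ∈ L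

data Least {n} (Γ : Pred (Form n) a) : Pred (Form n) a where
  ax   : ∀ {A} → A ∈ Γ → Least Γ A
  taut : ∀ {A} → Tautology A → Least Γ A
  K-ax : ∀ i p q → Least Γ (□ i (var p ⇒ var q) ⇒ □ i (var p) ⇒ □ i (var q))
  sub  : ∀ σ {A} → Least Γ A → Least Γ (subst σ A)
  mp   : ∀ {A B} → Least Γ (A ⇒ B) → Least Γ A → Least Γ B
  nec  : ∀ i {A} → Least Γ A → Least Γ (□ i A)

Least-isLogic : (Γ : Pred (Form n) a) → IsLogic (Least Γ)
Least-isLogic Γ = record { taut = taut ; K-ax = K-ax ; sub = sub ; mp = mp ; nec = nec }

Least-minimal : {Γ : Pred (Form n) a} {L : Pred (Form n) b} →
                IsLogic L → Γ ⊆ L → Least Γ ⊆ L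
Least-minimal {Γ = Γ} {L = L} isL Γ⊆L = go
  where
  module L = IsLogic isL
  go : Least Γ ⊆ L
  go (ax A∈Γ)     = Γ⊆L A∈Γ
  go (taut t)     = L.taut t
  go (K-ax i p q) = L.K-ax i p q
  go (sub σ d)    = L.sub σ (go d)
  go (mp d e)     = L.mp (go d) (go e)
  go (nec i d)    = L.nec i (go d)

K : (n : ℕ) → Pred (Form n) 0ℓ
K n = Least ∅

infixl 6 _+_

_+_ : Pred (Form n) a → Pred (Form n) a → Pred (Form n) a
L + Γ = Least (L ∪ Γ)

data HTCAxiom : Pred (Form 1) 0ℓ where
  closed : ∀ {A} → Closed A → HTCAxiom A
  □⇒□^   : ∀ p k → HTCAxiom (□ zero (var p) ⇒ □^ k (var p))

IsHTC : Pred (Form 1) 0ℓ → Set₁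
IsHTC L = Σ (Pred (Form 1) 0ℓ) λ Γ → Γ ⊆ HTCAxiom × L ≐ K 1 + Γ

------------------------------------------------------------------------
-- Fusion, and its extension by Δ

embed : Fin 2 → Form 1 → Form 2
embed i (var p) = var p
embed i ⊥ᶠ      = ⊥ᶠ
embed i (A ⇒ B) = embed i A ⇒ embed i B
embed i (□ _ A) = □ i (embed i A)

data Embed (i : Fin 2) (L : Pred (Form 1) a) : Pred (Form 2) a where
  embedded : ∀ {A} → A ∈ L → Embed i L (embed i A)

_∗_ : Pred (Form 1) 0ℓ → Pred (Form 1) 0ℓ → Pred (Form 2) 0ℓ
L₁ ∗ L₂ = K 2 + Embed zero L₁ + Embed (suc zero) L₂

data Δ : Pred (Form 2) 0ℓ where
  □₂-intro : ∀ {B} → Closed B → □-Free (suc zero) B → Δ (B ⇒ □ (suc zero) B)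
  □₁-intro : ∀ {B} → Closed B → □-Free zero B → Δ (B ⇒ □ zero B)

⟨_,_⟩ : Pred (Form 1) 0ℓ → Pred (Form 1) 0ℓ → Pred (Form 2) 0ℓ
⟨ L₁ , L₂ ⟩ = (L₁ ∗ L₂) + Δ

------------------------------------------------------------------------
-- Neighborhood frames

-- Subsets of X : Set ℓ are predicates in Pred X ℓ, so quantifying over them
-- puts families of subsets, and hence truth of modal formulas, one level up.
-- No extensionality of predicates is needed: closure under supersets makes
-- membership in a filter invariant under _≐_.
record IsFilter {X : Set ℓ} (𝓕 : Pred (Pred X ℓ) (lsuc ℓ)) : Set (lsuc ℓ) where
  field
    whole : U ∈ 𝓕
    inter : ∀ {V W} → V ∈ 𝓕 → W ∈ 𝓕 → (V ∩ W) ∈ 𝓕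
    upper : ∀ {V W} → V ⊆ W → V ∈ 𝓕 → W ∈ 𝓕

record NFrame (n : ℕ) (ℓ : Level) : Set (lsuc (lsuc ℓ)) where
  field
    Carrier  : Set ℓ
    nonempty : Carrier
    τ        : Fin n → Carrier → Pred (Pred Carrier ℓ) (lsuc ℓ)
    filter   : ∀ i x → IsFilter (τ i x)

module _ (𝔛 : NFrame n ℓ) where
  open NFrame 𝔛

  Truth : (ℕ → Pred Carrier ℓ) → Form n → Pred Carrier (lsuc ℓ)
  Truth θ (var p) x = Lift (lsuc ℓ) (θ p x)
  Truth θ ⊥ᶠ      x = Lift (lsuc ℓ) ⊥
  Truth θ (A ⇒ B) x = Truth θ A x → Truth θ B x
  Truth θ (□ i A) x = ∃ λ V → V ∈ τ i x × V ⊆ Truth θ A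

  Valid : Form n → Set (lsuc ℓ)
  Valid A = ∀ θ x → Truth θ A x

Log : Pred (NFrame n ℓ) a → Pred (Form n) _
Log 𝓒 A = ∀ 𝔛 → 𝔛 ∈ 𝓒 → Valid 𝔛 A

nV : (ℓ : Level) → Pred (Form n) 0ℓ → Pred (NFrame n ℓ) (lsuc ℓ)
nV ℓ L 𝔛 = ∀ {A} → A ∈ L → Valid 𝔛 A

------------------------------------------------------------------------
-- Products

module _ (𝔛₁ 𝔛₂ : NFrame 1 ℓ) where
  private
    module 𝔛₁ = NFrame 𝔛₁
    module 𝔛₂ = NFrame 𝔛₂

  τ× : Fin 2 → 𝔛₁.Carrier × 𝔛₂.Carrier →
       Pred (Pred (𝔛₁.Carrier × 𝔛₂.Carrier) ℓ) (lsuc ℓ)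
  τ× zero       (x₁ , x₂) W = ∃ λ V → V ∈ 𝔛₁.τ zero x₁ × (V ⟨×⟩ ｛ x₂ ｝) ⊆ W
  τ× (suc zero) (x₁ , x₂) W = ∃ λ V → V ∈ 𝔛₂.τ zero x₂ × (｛ x₁ ｝ ⟨×⟩ V) ⊆ W

  τ×-filter : ∀ i x → IsFilter (τ× i x)
  τ×-filter zero (x₁ , x₂) = record
    { whole = U , whole , _
    ; inter = λ (V , V∈ , V⊆) (W , W∈ , W⊆) → V ∩ W , inter V∈ W∈ ,
        λ ((v , w) , eq) → V⊆ (v , eq) , W⊆ (w , eq)
    ; upper = λ S⊆T (V , V∈ , V⊆) → V , V∈ , λ z → S⊆T (V⊆ z)
    }
    where open IsFilter (𝔛₁.filter zero x₁)
  τ×-filter (suc zero) (x₁ , x₂) = record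
    { whole = U , whole , _
    ; inter = λ (V , V∈ , V⊆) (W , W∈ , W⊆) → V ∩ W , inter V∈ W∈ ,
        λ (eq , (v , w)) → V⊆ (eq , v) , W⊆ (eq , w)
    ; upper = λ S⊆T (V , V∈ , V⊆) → V , V∈ , λ z → S⊆T (V⊆ z)
    }
    where open IsFilter (𝔛₂.filter zero x₂)

  _⊗_ : NFrame 2 ℓ
  _⊗_ = record
    { Carrier  = 𝔛₁.Carrier × 𝔛₂.Carrier
    ; nonempty = 𝔛₁.nonempty , 𝔛₂.nonempty
    ; τ        = τ×
    ; filter   = τ×-filter
    }

data Products {ℓ} (𝓒₁ 𝓒₂ : Pred (NFrame 1 ℓ) (lsuc ℓ)) :
              Pred (NFrame 2 ℓ) (lsuc (lsuc ℓ)) where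
  product : ∀ {𝔛₁ 𝔛₂} → 𝔛₁ ∈ 𝓒₁ → 𝔛₂ ∈ 𝓒₂ → Products 𝓒₁ 𝓒₂ (𝔛₁ ⊗ 𝔛₂)

nProduct : (ℓ : Level) → Pred (Form 1) 0ℓ → Pred (Form 1) 0ℓ →
           Pred (Form 2) (lsuc (lsuc ℓ))
nProduct ℓ L₁ L₂ = Log (Products (nV ℓ L₁) (nV ℓ L₂))

syntax nProduct ℓ L₁ L₂ = L₁ ×ₙ[ ℓ ] L₂

{-# OPTIONS --safe #-}
module Submission where

-- Soundness: in a product, a closed □₂-free formula depends only on the first
-- coordinate, which makes Δ valid.
--
-- Completeness: let s₀ be a world of the canonical model of ⟨ L₁ , L₂ ⟩ omitting
-- a given non-theorem.  Points of the i-th factor are finite sequences of moves,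
-- each either a pause or a world w, meaning "go to w if it is an Rᵢ-successor of
-- the current world; otherwise go to an Rᵢ-successor satisfying the same closed
-- formulas of the i-th language as w; otherwise stay".  Because of Δ these closed
-- formulas are preserved by moves of the other factor, so whether a move is
-- possible depends on one factor only.  Neighbourhoods of α consist of the
-- extensions of α that pause long enough first and then follow Rᵢ; interleaving
-- α and β position by position from s₀ is then a bounded morphism from the
-- product to the canonical model, since a sufficiently long pause lets all of β
-- be executed before α is continued.  Closed axioms hold in the factors by the
-- truth lemma, and □p → □ᵏp because Rᵢ has the corresponding Horn property.

open import Defs
open import Level using (Level; 0ℓ; Lift; lift; lower) renaming (suc to lsuc)
open import Relation.Unary using (Pred; _∈_; _∉_; _⊆_; _≐_; _∪_; ｛_｝; ∅; Satisfiable)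
open import Axiom.ExcludedMiddle using (ExcludedMiddle)
open import Data.Bool.Base using (Bool; true; false; not; _∨_)
open import Data.Bool.Properties using () renaming (_≟_ to _≟ᵇ_)
open import Data.Empty using (⊥; ⊥-elim)
open import Data.Fin.Base using (Fin; zero; suc; toℕ; opposite)
open import Data.Fin.Properties using (toℕ-injective)
open import Data.List.Base using (List; []; _∷_; _++_; foldl; length)
open import Data.List.Properties using (foldl-++; ++-assoc; ++-identityʳ)
open import Data.Maybe.Base using (Maybe; just; nothing)
open import Data.Nat.Base
  using (ℕ; zero; suc; _*_; _≤_; z≤n; s≤s; _⊔_; _≤′_; ≤′-refl; ≤′-step)
open import Data.Nat.Properties
  using (*-cancelˡ-≡; even≢odd; suc-injective; m≤m⊔n; m≤n⊔m; n≤1+n; ≤⇒≤′)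
open import Data.Product.Base using (∃-syntax; _×_; _,_; proj₁; proj₂)
open import Data.Sum.Base using (_⊎_; inj₁; inj₂)
open import Data.Unit.Base using (⊤; tt)
open import Function.Base using (_∘_; id)
open import Relation.Binary.PropositionalEquality
  using (_≡_; refl; sym; trans; cong; cong₂) renaming (subst to ≡-subst)
open import Relation.Nullary using (¬_; Dec; yes; no; does; contradiction)
open import Relation.Nullary.Decidable using (dec-true)

private
  variable
    n : ℕ
    a ℓ : Level

-- Numbering of formulas

pair : ℕ → ℕ → ℕ
pair zero    k = suc (2 * k)
pair (suc m) k = 2 * pair m k

-- `pair m k` is 2^m (2k + 1): parity tells whether another factor 2 can be cancelled.
pair-injective : ∀ m m′ k k′ → pair m k ≡ pair m′ k′ → m ≡ m′ × k ≡ k′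
pair-injective zero    zero     k k′ eq =
  refl , *-cancelˡ-≡ k k′ 2 (suc-injective eq)
pair-injective zero    (suc m′) k k′ eq = contradiction (sym eq) (even≢odd (pair m′ k′) k)
pair-injective (suc m) zero     k k′ eq = contradiction eq (even≢odd (pair m k) k′)
pair-injective (suc m) (suc m′) k k′ eq
  with pair-injective m m′ k k′ (*-cancelˡ-≡ (pair m k) (pair m′ k′) 2 eq)
... | refl , refl = refl , refl

tag : Form n → ℕ
tag (var _) = 0
tag ⊥ᶠ      = 1
tag (_ ⇒ _) = 2
tag (□ _ _) = 3

mutual
  code : Form n → ℕ
  code A = pair (tag A) (body A)

  body : Form n → ℕ
  body (var p) = p
  body ⊥ᶠ      = 0
  body (A ⇒ B) = pair (code A) (code B)
  body (□ i A) = pair (toℕ i) (code A)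

mutual
  code-injective : ∀ (A B : Form n) → code A ≡ code B → A ≡ B
  code-injective A B eq =
    let tags , bodies = pair-injective (tag A) (tag B) (body A) (body B) eq
    in tag-body-injective A B tags bodies

  tag-body-injective : ∀ (A B : Form n) → tag A ≡ tag B → body A ≡ body B → A ≡ B
  tag-body-injective (var p) (var q) refl eq = cong var eq
  tag-body-injective ⊥ᶠ      ⊥ᶠ      refl eq = refl
  tag-body-injective (A ⇒ B) (C ⇒ D) refl eq =
    let eq₁ , eq₂ = pair-injective (code A) (code C) (code B) (code D) eq
    in cong₂ _⇒_ (code-injective A C eq₁) (code-injective B D eq₂)
  tag-body-injective (□ i A) (□ j B) refl eq =
    let eq₁ , eq₂ = pair-injective (toℕ i) (toℕ j) (code A) (code B) eq
    in cong₂ □ (toℕ-injective eq₁) (code-injective A B eq₂)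

-- Theorems of an arbitrary normal logic

infixr 7 _∧ᶠ_

¬ᶠ_ : Form n → Form n
¬ᶠ A = A ⇒ ⊥ᶠ

_∧ᶠ_ : Form n → Form n → Form n
A ∧ᶠ B = ¬ᶠ (A ⇒ ¬ᶠ B)

private
  infixr 6 _⇒ᵇ_

  _⇒ᵇ_ : Bool → Bool → Bool
  x ⇒ᵇ y = not x ∨ y

module Theorems {L : Pred (Form n) a} (isLogic : IsLogic L) where
  private module L = IsLogic isLogic

  ⇒-refl : ∀ {A} → (A ⇒ A) ∈ L
  ⇒-refl {A} = L.taut λ v → go (eval v A)
    where
    go : ∀ x → x ⇒ᵇ x ≡ true
    go true  = refl
    go false = refl

  ⇒-const : ∀ {A B} → (A ⇒ B ⇒ A) ∈ L
  ⇒-const {A} {B} = L.taut λ v → go (eval v A) (eval v B)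
    where
    go : ∀ x y → x ⇒ᵇ y ⇒ᵇ x ≡ true
    go true  true  = refl
    go true  false = refl
    go false _     = refl

  ⇒-distrib : ∀ {A B C} → ((A ⇒ B ⇒ C) ⇒ (A ⇒ B) ⇒ A ⇒ C) ∈ L
  ⇒-distrib {A} {B} {C} = L.taut λ v → go (eval v A) (eval v B) (eval v C)
    where
    go : ∀ x y z → (x ⇒ᵇ y ⇒ᵇ z) ⇒ᵇ (x ⇒ᵇ y) ⇒ᵇ x ⇒ᵇ z ≡ true
    go true  true  true  = refl
    go true  true  false = refl
    go true  false _     = refl
    go false _     _     = refl

  -- Classically `A` or `A ⇒ B` holds; this puts one of the two into every maximal theory.
  ⇒-cases : ∀ {A B C} → ((A ⇒ C) ⇒ ((A ⇒ B) ⇒ C) ⇒ C) ∈ L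
  ⇒-cases {A} {B} {C} = L.taut λ v → go (eval v A) (eval v B) (eval v C)
    where
    go : ∀ x y z → (x ⇒ᵇ z) ⇒ᵇ ((x ⇒ᵇ y) ⇒ᵇ z) ⇒ᵇ z ≡ true
    go true  true  true  = refl
    go true  true  false = refl
    go true  false true  = refl
    go true  false false = refl
    go false _     true  = refl
    go false _     false = refl

  ∧-intro : ∀ {A B} → (A ⇒ B ⇒ A ∧ᶠ B) ∈ L
  ∧-intro {A} {B} = L.taut λ v → go (eval v A) (eval v B)
    where
    go : ∀ x y → x ⇒ᵇ y ⇒ᵇ ((x ⇒ᵇ y ⇒ᵇ false) ⇒ᵇ false) ≡ true
    go true  true  = refl
    go true  false = refl
    go false _     = refl

  ∧-mp : ∀ {A B C D} → ((C ⇒ A ⇒ B) ⇒ (D ⇒ A) ⇒ C ∧ᶠ D ⇒ B) ∈ L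
  ∧-mp {A} {B} {C} {D} = L.taut λ v →
    go (eval v C) (eval v D) (eval v A) (eval v B)
    where
    go : ∀ c d x y →
         (c ⇒ᵇ x ⇒ᵇ y) ⇒ᵇ (d ⇒ᵇ x) ⇒ᵇ ((c ⇒ᵇ d ⇒ᵇ false) ⇒ᵇ false) ⇒ᵇ y ≡ true
    go true  true  true  true  = refl
    go true  true  true  false = refl
    go true  true  false _     = refl
    go true  false true  true  = refl
    go true  false true  false = refl
    go true  false false _     = refl
    go false true  true  _     = refl
    go false true  false _     = refl
    go false false _     _     = refl

  K-instance : ∀ {i A B} → (□ i (A ⇒ B) ⇒ □ i A ⇒ □ i B) ∈ L
  K-instance {i} {A} {B} = L.sub (λ { zero → A ; (suc _) → B }) (L.K-ax i 0 1)

-- Canonical model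

does⇒ : ∀ {P : Set a} (P? : Dec P) → does P? ≡ true → P
does⇒ (yes p) _ = p

module Canonical (em : ∀ {a} → ExcludedMiddle a)
                 {L : Pred (Form n) 0ℓ} (isLogic : IsLogic L) where
  private module L = IsLogic isLogic
  open Theorems isLogic

  infix 4 _⊢_ _∈ʷ_ _∈ʷ?_

  -- Necessitation and substitution are confined to theorems, so the deduction theorem holds.
  data _⊢_ (Γ : Pred (Form n) 0ℓ) : Form n → Set where
    thm : ∀ {A} → A ∈ L → Γ ⊢ A
    hyp : ∀ {A} → A ∈ Γ → Γ ⊢ A
    mp  : ∀ {A B} → Γ ⊢ A ⇒ B → Γ ⊢ A → Γ ⊢ B

  weaken : ∀ {Γ Γ′ A} → Γ ⊆ Γ′ → Γ ⊢ A → Γ′ ⊢ A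
  weaken s (thm x)  = thm x
  weaken s (hyp x)  = hyp (s x)
  weaken s (mp d e) = mp (weaken s d) (weaken s e)

  deduction : ∀ {Γ A B} → (Γ ∪ ｛ A ｝) ⊢ B → Γ ⊢ A ⇒ B
  deduction (thm x)           = mp (thm ⇒-const) (thm x)
  deduction (hyp (inj₁ x))    = mp (thm ⇒-const) (hyp x)
  deduction (hyp (inj₂ refl)) = thm ⇒-refl
  deduction (mp d e)          = mp (mp (thm ⇒-distrib) (deduction d)) (deduction e)

  -- Boolean membership keeps worlds in `Set`, so that paths of worlds can be lifted to any level.
  record World : Set where
    field
      mem    : Form n → Bool
      thm-∈  : ∀ {A} → A ∈ L → mem A ≡ true
      mp-∈   : ∀ {A B} → mem (A ⇒ B) ≡ true → mem A ≡ true → mem B ≡ true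
      ⇒-∈    : ∀ {A B} → (mem A ≡ true → mem B ≡ true) → mem (A ⇒ B) ≡ true
      ⊥-∉    : ¬ mem ⊥ᶠ ≡ true

  open World public

  _∈ʷ_ : Form n → World → Set
  A ∈ʷ w = mem w A ≡ true

  _∈ʷ?_ : ∀ A w → Dec (A ∈ʷ w)
  A ∈ʷ? w = mem w A ≟ᵇ true

  module _ {Γ : Pred (Form n) 0ℓ} {A : Form n} (Γ⊬A : ¬ Γ ⊢ A) where
    private
      stage : ℕ → Pred (Form n) 0ℓ
      stage zero    = Γ
      -- Only the formula with code `k` is considered here; it joins if `A` stays underivable.
      stage (suc k) B = stage k B ⊎ (code B ≡ k × ¬ (stage k ∪ ｛ B ｝) ⊢ A)

      limit : Pred (Form n) 0ℓ
      limit B = ∃[ k ] B ∈ stage k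

      stage-⊬ : ∀ k → ¬ stage k ⊢ A
      stage-⊬ zero    = Γ⊬A
      stage-⊬ (suc k) d with em {P = ∃[ B ] code B ≡ k × ¬ (stage k ∪ ｛ B ｝) ⊢ A}
      ... | no none = stage-⊬ k (weaken (λ
        { (inj₁ x) → x ; (inj₂ y) → ⊥-elim (none (_ , y)) }) d)
      -- By injectivity of `code`, whatever entered at this stage is `B`.
      ... | yes (B , eq , ⊬A) = ⊬A (weaken (λ
        { (inj₁ x) → inj₁ x
        ; (inj₂ (eq′ , _)) → inj₂ (code-injective B _ (trans eq (sym eq′))) }) d)

      stage-mono : ∀ {k k′} → k ≤′ k′ → stage k ⊆ stage k′
      stage-mono ≤′-refl       x = x
      stage-mono (≤′-step k≤) x = inj₁ (stage-mono k≤ x)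

      limit-⊢ : ∀ {B} → limit ⊢ B → ∃[ k ] stage k ⊢ B
      limit-⊢ (thm x)       = 0 , thm x
      limit-⊢ (hyp (k , x)) = k , hyp x
      limit-⊢ (mp d e) with limit-⊢ d | limit-⊢ e
      ... | k , d′ | k′ , e′ = k ⊔ k′ ,
        mp (weaken (stage-mono (≤⇒≤′ (m≤m⊔n k k′))) d′)
           (weaken (stage-mono (≤⇒≤′ (m≤n⊔m k k′))) e′)

      limit-⊬ : ¬ limit ⊢ A
      limit-⊬ d = let k , d′ = limit-⊢ d in stage-⊬ k d′

      -- `B` was considered at stage `code B` and was refused only if it yields `A`.
      limit-maximal : ∀ {B} → B ∉ limit → limit ⊢ B ⇒ A
      limit-maximal {B} B∉ with em {P = (stage (code B) ∪ ｛ B ｝) ⊢ A}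
      ... | yes d = weaken (code B ,_) (deduction d)
      ... | no ⊬A = ⊥-elim (B∉ (suc (code B) , inj₂ (refl , ⊬A)))

      limit-closed : ∀ {B} → limit ⊢ B → B ∈ limit
      limit-closed {B} d with em {P = B ∈ limit}
      ... | yes B∈ = B∈
      ... | no B∉ = ⊥-elim (limit-⊬ (mp (limit-maximal B∉) d))

      limit-⇒ : ∀ {B C} → (B ∈ limit → C ∈ limit) → (B ⇒ C) ∈ limit
      limit-⇒ {B} {C} f with em {P = B ∈ limit} | em {P = (B ⇒ C) ∈ limit}
      ... | _      | yes ∈  = ∈
      ... | yes B∈ | no _   = limit-closed (mp (thm ⇒-const) (hyp (f B∈)))
      ... | no B∉  | no B⇒C∉ = ⊥-elim (limit-⊬
        (mp (mp (thm ⇒-cases) (limit-maximal B∉)) (limit-maximal B⇒C∉)))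

      member : Form n → Bool
      member B = does (em {P = B ∈ limit})

      to : ∀ {B} → B ∈ limit → member B ≡ true
      to = dec-true em

      from : ∀ {B} → member B ≡ true → B ∈ limit
      from = does⇒ em

    lindenbaum : ∃[ w ] (∀ {B} → B ∈ Γ → B ∈ʷ w) × ¬ A ∈ʷ w
    lindenbaum = record
      { mem   = member
      ; thm-∈ = to ∘ limit-closed ∘ thm
      ; mp-∈  = λ B⇒C B → to (limit-closed (mp (hyp (from B⇒C)) (hyp (from B))))
      ; ⇒-∈   = λ f → to (limit-⇒ (from ∘ f ∘ to))
      ; ⊥-∉   = λ ⊥∈ → limit-⊬ (mp (thm (L.taut λ _ → refl)) (hyp (from ⊥∈)))
      } , (λ x → to (0 , x)) , λ A∈ → limit-⊬ (hyp (from A∈))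

  ¬-∈ : ∀ {A} w → ¬ A ∈ʷ w → (¬ᶠ A) ∈ʷ w
  ¬-∈ w A∉ = ⇒-∈ w (⊥-elim ∘ A∉)

  □-mp : ∀ {i A B} w → □ i (A ⇒ B) ∈ʷ w → □ i A ∈ʷ w → □ i B ∈ʷ w
  □-mp w d e = mp-∈ w (mp-∈ w (thm-∈ w K-instance) d) e

  □-mono : ∀ {i A B} w → (A ⇒ B) ∈ L → □ i A ∈ʷ w → □ i B ∈ʷ w
  □-mono w t = □-mp w (thm-∈ w (L.nec _ t))

  record R (i : Fin n) (w u : World) : Set where
    constructor related
    field unbox : ∀ {A} → □ i A ∈ʷ w → A ∈ʷ u

  open R public

  module _ {i : Fin n} {w : World} {S : Pred (Form n) 0ℓ} (S-⊤ : (⊥ᶠ ⇒ ⊥ᶠ) ∈ S)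
           (S-∧ : ∀ {A B} → A ∈ S → B ∈ S → (A ∧ᶠ B) ∈ S) where

    -- A derivation uses finitely many members of `S`; closure under conjunction merges them into
    -- one `C`.
    collect : ∀ {A} → ((λ B → □ i B ∈ʷ w) ∪ S) ⊢ A →
              ∃[ C ] C ∈ S × □ i (C ⇒ A) ∈ʷ w
    collect (thm x) = _ , S-⊤ ,
      thm-∈ w (L.nec i (L.mp ⇒-const x))
    collect (hyp (inj₁ x)) = _ , S-⊤ , □-mono w ⇒-const x
    collect (hyp (inj₂ x)) = _ , x , thm-∈ w (L.nec i ⇒-refl)
    collect (mp d e) with collect d | collect e
    ... | C , C∈ , c | D , D∈ , d′ = C ∧ᶠ D , S-∧ C∈ D∈ ,
      □-mp w (□-mono w ∧-mp c) d′

    -- With `S = L` this gives the usual existence lemma; with `S` a local theory it gives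
    -- `∼-successor`.
    successor : ∀ {A} → (∀ {C} → C ∈ S → ¬ □ i (C ⇒ A) ∈ʷ w) →
                ∃[ u ] R i w u × (∀ {C} → C ∈ S → C ∈ʷ u) × ¬ A ∈ʷ u
    successor h with lindenbaum (λ d → let C , C∈ , c = collect d in h C∈ c)
    ... | u , ⊆u , A∉u = u , related (λ x → ⊆u (inj₁ x)) , (λ x → ⊆u (inj₂ x)) , A∉u

  □-successor : ∀ {i A} w → ¬ □ i A ∈ʷ w → ∃[ u ] R i w u × ¬ A ∈ʷ u
  □-successor {i} w □A∉
    with successor {i} {w} {S = L} (L.taut λ _ → refl)
           (λ x y → L.mp (L.mp ∧-intro x) y)
           (λ C∈ □C⇒A → □A∉ (□-mp w □C⇒A (thm-∈ w (L.nec i C∈))))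
  ... | u , wRu , _ , A∉u = u , wRu , A∉u

-- Local formulas and delayed sequences of moves

-- Closed formulas of the i-th language, i.e. with no modality but □ i.
Local : Fin 2 → Form 2 → Set
Local i B = Closed B × □-Free (opposite i) B

Local-□ : ∀ i {B} → Local i B → Local i (□ i B)
Local-□ zero       (c , f) = c , (λ ()) , f
Local-□ (suc zero) (c , f) = c , (λ ()) , f

-- The first k entries, or all of them if there are fewer, are pauses.
Delayed : {X : Set} → ℕ → List (Maybe X) → Set
Delayed zero    _             = ⊤
Delayed (suc k) []            = ⊤
Delayed (suc k) (nothing ∷ δ) = Delayed k δ
Delayed (suc k) (just _ ∷ _)  = ⊥

module _ {X : Set} where

  Delayed-[] : ∀ k → Delayed {X} k []
  Delayed-[] zero    = tt
  Delayed-[] (suc k) = tt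

  Delayed-mono : ∀ {k k′} → k ≤ k′ → (δ : List (Maybe X)) → Delayed k′ δ → Delayed k δ
  Delayed-mono z≤n       _             _ = tt
  Delayed-mono (s≤s k≤) []            _ = tt
  Delayed-mono (s≤s k≤) (nothing ∷ δ) d = Delayed-mono k≤ δ d

  -- A `δ` shorter than `k` consists of pauses only, and `δ′` supplies the missing ones.
  Delayed-++ : ∀ k (δ δ′ : List (Maybe X)) → Delayed k δ → Delayed k δ′ → Delayed k (δ ++ δ′)
  Delayed-++ zero    _             _  _ _  = tt
  Delayed-++ (suc k) []            δ′ _ d′ = d′
  Delayed-++ (suc k) (nothing ∷ δ) δ′ d d′ =
    Delayed-++ k δ δ′ d (Delayed-mono (n≤1+n k) δ′ d′)

  pausing : ℕ → X → List (Maybe X)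
  pausing zero    x = just x ∷ []
  pausing (suc k) x = nothing ∷ pausing k x

  Delayed-pausing : ∀ k {x} → Delayed k (pausing k x)
  Delayed-pausing zero    = tt
  Delayed-pausing (suc k) = Delayed-pausing k

-- Truth in products and validity of Δ

module ProductTruth (𝔛 : Fin 2 → NFrame 1 ℓ) where
  private module 𝔛 i = NFrame (𝔛 i)

  𝔓 : NFrame 2 ℓ
  𝔓 = 𝔛 zero ⊗ 𝔛 (suc zero)

  Point : Set ℓ
  Point = 𝔛.Carrier zero × 𝔛.Carrier (suc zero)

  coord : ∀ i → Point → 𝔛.Carrier i
  coord zero       = proj₁
  coord (suc zero) = proj₂

  put : ∀ i → 𝔛.Carrier i → Point → Point
  put zero       x (_ , y) = x , y
  put (suc zero) y (x , _) = x , y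

  put-coord : ∀ i z → put i (coord i z) z ≡ z
  put-coord zero       _ = refl
  put-coord (suc zero) _ = refl

  module _ {θ : ℕ → Pred Point ℓ} where

    □-put⁻ : ∀ i {A x z} → Truth 𝔓 θ (□ i A) (put i x z) →
             ∃[ V ] V ∈ 𝔛.τ i zero x × (∀ {y} → y ∈ V → Truth 𝔓 θ A (put i y z))
    □-put⁻ zero       (_ , (V , V∈ , V⊆) , ⊨A) = V , V∈ , λ y∈ → ⊨A (V⊆ (y∈ , refl))
    □-put⁻ (suc zero) (_ , (V , V∈ , V⊆) , ⊨A) = V , V∈ , λ y∈ → ⊨A (V⊆ (refl , y∈))

    □-put⁺ : ∀ i {A x z V} → V ∈ 𝔛.τ i zero x →
             (∀ {y} → y ∈ V → Truth 𝔓 θ A (put i y z)) → Truth 𝔓 θ (□ i A) (put i x z)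
    □-put⁺ zero       {V = V} V∈ ⊨A = _ , (V , V∈ , id) , λ { (y∈ , refl) → ⊨A y∈ }
    □-put⁺ (suc zero) {V = V} V∈ ⊨A = _ , (V , V∈ , id) , λ { (refl , y∈) → ⊨A y∈ }

    □⁻ : ∀ i {A} z → Truth 𝔓 θ (□ i A) z →
         ∃[ V ] V ∈ 𝔛.τ i zero (coord i z) × (∀ {y} → y ∈ V → Truth 𝔓 θ A (put i y z))
    □⁻ i {A} z t = □-put⁻ i (≡-subst (Truth 𝔓 θ (□ i A)) (sym (put-coord i z)) t)

    □⁺ : ∀ i {A} z {V} → V ∈ 𝔛.τ i zero (coord i z) →
         (∀ {y} → y ∈ V → Truth 𝔓 θ A (put i y z)) → Truth 𝔓 θ (□ i A) z
    □⁺ i {A} z V∈ ⊨A = ≡-subst (Truth 𝔓 θ (□ i A)) (put-coord i z) (□-put⁺ i V∈ ⊨A)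

    line : ∀ i → Point → ℕ → Pred (𝔛.Carrier i) ℓ
    line i z p x = θ p (put i x z)

    mutual
      -- The box of one factor never leaves the line through `z`, so only the valuation on that line
      -- matters.
      embed⁺ : ∀ i A {x z} → Truth (𝔛 i) (line i z) A x → Truth 𝔓 θ (embed i A) (put i x z)
      embed⁺ i (var p)    t = t
      embed⁺ i (A ⇒ B)    t = embed⁺ i B ∘ t ∘ embed⁻ i A
      embed⁺ i (□ zero A) (V , V∈ , ⊨A) = □-put⁺ i V∈ (λ y∈ → embed⁺ i A (⊨A y∈))

      embed⁻ : ∀ i A {x z} → Truth 𝔓 θ (embed i A) (put i x z) → Truth (𝔛 i) (line i z) A x
      embed⁻ i (var p)    t = t
      embed⁻ i (A ⇒ B)    t = embed⁻ i B ∘ t ∘ embed⁺ i A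
      embed⁻ i (□ zero A) t =
        let V , V∈ , ⊨A = □-put⁻ i t in V , V∈ , λ y∈ → embed⁻ i A (⊨A y∈)

    -- Without letters the valuation is never consulted, and the only box allowed moves coordinate
    -- `i` alone.
    Local-invariant : ∀ i B x z z′ → Local i B →
                      Truth 𝔓 θ B (put i x z) → Truth 𝔓 θ B (put i x z′)
    Local-invariant i ⊥ᶠ x z z′ _ t = t
    Local-invariant i (B ⇒ C) x z z′ ((cB , cC) , (fB , fC)) t =
      Local-invariant i C x z z′ (cC , fC) ∘ t ∘ Local-invariant i B x z′ z (cB , fB)
    Local-invariant zero (□ zero B) x z z′ (c , _ , f) t =
      let V , V∈ , ⊨B = □-put⁻ zero {z = z} t
      in □-put⁺ zero {z = z′} V∈ (λ y∈ → Local-invariant zero B _ z z′ (c , f) (⊨B y∈))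
    Local-invariant (suc zero) (□ (suc zero) B) x z z′ (c , _ , f) t =
      let V , V∈ , ⊨B = □-put⁻ (suc zero) {z = z} t
      in □-put⁺ (suc zero) {z = z′} V∈
           (λ y∈ → Local-invariant (suc zero) B _ z z′ (c , f) (⊨B y∈))
    Local-invariant zero       (□ (suc zero) B) _ _ _ (_ , 1≢1 , _) t = ⊥-elim (1≢1 refl)
    Local-invariant (suc zero) (□ zero B)       _ _ _ (_ , 0≢0 , _) t = ⊥-elim (0≢0 refl)

  embed-valid : ∀ i A → Valid (𝔛 i) A → Valid 𝔓 (embed i A)
  embed-valid i A ⊨A θ z =
    ≡-subst (Truth 𝔓 θ (embed i A)) (put-coord i z) (embed⁺ i A (⊨A _ (coord i z)))

  -- `B` persists along the whole line of the other factor, so the whole set serves as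
  -- neighbourhood.
  Δ-valid : Δ ⊆ Valid 𝔓
  Δ-valid (□₂-intro {B} c f) θ (x , y) t =
    □⁺ (suc zero) (x , y) whole (λ {y′} _ → Local-invariant zero B x (x , y) (x , y′) (c , f) t)
    where open IsFilter (𝔛.filter (suc zero) zero y)
  Δ-valid (□₁-intro {B} c f) θ (x , y) t =
    □⁺ zero (x , y) whole (λ {x′} _ → Local-invariant (suc zero) B y (x , y) (x′ , y) (c , f) t)
    where open IsFilter (𝔛.filter zero zero x)

Closed-Truth : ∀ {𝔛 : NFrame n ℓ} {θ θ′} A → Closed A → Truth 𝔛 θ A ⊆ Truth 𝔛 θ′ A
Closed-Truth ⊥ᶠ      _         t = t
Closed-Truth (A ⇒ B) (cA , cB) t = Closed-Truth B cB ∘ t ∘ Closed-Truth A cA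
Closed-Truth (□ i A) c (V , V∈ , ⊨A) = V , V∈ , λ y∈ → Closed-Truth A c (⊨A y∈)

-- Validity in a frame is a normal logic

module Soundness (em : ∀ {a} → ExcludedMiddle a) (𝔛 : NFrame n ℓ) where
  open NFrame 𝔛

  does-em : Set (lsuc ℓ) → Bool
  does-em P = does (em {P = P})

  module _ (θ : ℕ → Pred Carrier ℓ) where
    private
      val : Carrier → Form n → Bool
      val x A = does-em (Truth 𝔛 θ A x)

    mutual
      -- Truth at a point is a Boolean valuation with boxed formulas as atoms, hence tautologies are
      -- valid.
      eval⁺ : ∀ A {x} → Truth 𝔛 θ A x → eval (val x) A ≡ true
      eval⁺ (var p) t = dec-true em t
      eval⁺ (A ⇒ B) {x} t with eval (val x) A in eq
      ... | false = refl
      ... | true  = eval⁺ B (t (eval⁻ A eq))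
      eval⁺ (□ i A) t = dec-true em t

      eval⁻ : ∀ A {x} → eval (val x) A ≡ true → Truth 𝔛 θ A x
      eval⁻ (var p) eq = does⇒ em eq
      eval⁻ (A ⇒ B) {x} eq t with eval (val x) A | eval⁺ A t
      ... | true | refl = eval⁻ B eq
      eval⁻ (□ i A) eq = does⇒ em eq

    -- Truth sets live one level above valuations; excluded middle brings
    -- them back down.
    substituted : (ℕ → Form n) → ℕ → Pred Carrier ℓ
    substituted σ p x = Lift ℓ (val x (σ p) ≡ true)

    mutual
      subst⁺ : ∀ σ A → Truth 𝔛 (substituted σ) A ⊆ Truth 𝔛 θ (subst σ A)
      subst⁺ σ (var p) (lift (lift eq)) = does⇒ em eq
      subst⁺ σ (A ⇒ B) t = subst⁺ σ B ∘ t ∘ subst⁻ σ A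
      subst⁺ σ (□ i A) (V , V∈ , ⊨A) = V , V∈ , λ y∈ → subst⁺ σ A (⊨A y∈)

      subst⁻ : ∀ σ A → Truth 𝔛 θ (subst σ A) ⊆ Truth 𝔛 (substituted σ) A
      subst⁻ σ (var p) t = lift (lift (dec-true em t))
      subst⁻ σ (A ⇒ B) t = subst⁻ σ B ∘ t ∘ subst⁺ σ A
      subst⁻ σ (□ i A) (V , V∈ , ⊨A) = V , V∈ , λ y∈ → subst⁻ σ A (⊨A y∈)

  Valid-isLogic : IsLogic (Valid 𝔛)
  Valid-isLogic = record
    { taut = λ {A} t θ x → eval⁻ θ A (t _)
    ; K-ax = λ { i p q θ x (V , V∈ , p⇒q) (W , W∈ , ⊨p) →
        _ , IsFilter.inter (filter i x) V∈ W∈ , λ (v , w) → p⇒q v (⊨p w) }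
    ; sub  = λ σ {A} ⊨A θ x → subst⁺ θ σ A (⊨A (substituted θ σ) x)
    ; mp   = λ ⊨A⇒B ⊨A θ x → ⊨A⇒B θ x (⊨A θ x)
    ; nec  = λ i ⊨A θ x → _ , IsFilter.whole (filter i x) , λ {y} _ → ⊨A θ y
    }

-- Iterated boxes under substitution

boxes : Fin n → ℕ → Form n → Form n
boxes i zero    A = A
boxes i (suc k) A = □ i (boxes i k A)

subst-embed-□^ : ∀ i k {p} σ → subst σ (embed i (□^ k (var p))) ≡ boxes i k (σ p)
subst-embed-□^ i zero    σ = refl
subst-embed-□^ i (suc k) σ = cong (□ i) (subst-embed-□^ i k σ)

-- Local equivalence and moves in the canonical model

module Paths (em : ∀ {a} → ExcludedMiddle a)
             {L : Pred (Form 2) 0ℓ} (isLogic : IsLogic L) (Δ⊆L : Δ ⊆ L) where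
  open Canonical em isLogic
  open Theorems isLogic
  private module L = IsLogic isLogic

  infix 4 _∼[_]_

  -- One direction suffices: local formulas are closed under negation, whence `∼-sym`.
  record _∼[_]_ (s : World) (i : Fin 2) (t : World) : Set where
    constructor agree
    field preserve : ∀ {B} → Local i B → B ∈ʷ s → B ∈ʷ t

  open _∼[_]_ public

  Δ-∈ : ∀ i {B} → Local i B → (B ⇒ □ (opposite i) B) ∈ L
  Δ-∈ zero       (c , f) = Δ⊆L (□₂-intro c f)
  Δ-∈ (suc zero) (c , f) = Δ⊆L (□₁-intro c f)

  ∼-reflexive : ∀ {i s t} → s ≡ t → s ∼[ i ] t
  ∼-reflexive refl = agree λ _ B∈s → B∈s

  ∼-refl : ∀ {i s} → s ∼[ i ] s
  ∼-refl = ∼-reflexive refl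

  ∼-trans : ∀ {i s t u} → s ∼[ i ] t → t ∼[ i ] u → s ∼[ i ] u
  ∼-trans p q = agree λ l → preserve q l ∘ preserve p l

  ∼-sym : ∀ {i s t} → s ∼[ i ] t → t ∼[ i ] s
  ∼-sym {i} {s} {t} s∼t = agree back
    where
    back : ∀ {B} → Local i B → B ∈ʷ t → B ∈ʷ s
    back {B} (c , f) B∈t with B ∈ʷ? s
    ... | yes B∈s = B∈s
    ... | no  B∉s = ⊥-elim (⊥-∉ t (mp-∈ t
      (preserve s∼t ((c , tt) , (f , tt)) (¬-∈ s B∉s)) B∈t))

  -- Here Δ enters: a local `B` in `s` is boxed by the other modality, hence passes to `t`.
  R⇒∼ : ∀ {i s t} → R (opposite i) s t → s ∼[ i ] t
  R⇒∼ {i} {s} sRt = agree λ l B∈s → unbox sRt (mp-∈ s (thm-∈ s (Δ-∈ i l)) B∈s)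

  -- The local theory of `u` is consistent with what `t` boxes: if `C` is in that theory and
  -- `□ i (¬ᶠ C)` is in `t`, the latter, being local, is also in `s`, and `u` would contain `¬ᶠ C`.
  ∼-successor : ∀ {i s t u} → s ∼[ i ] t → R i s u → ∃[ v ] R i t v × v ∼[ i ] u
  ∼-successor {i} {s} {t} {u} s∼t sRu
    with successor {i} {t} {S = λ C → Local i C × C ∈ʷ u}
           (((tt , tt) , (tt , tt)) , thm-∈ u ⇒-refl)
           (λ { ((cA , fA) , A∈) ((cB , fB) , B∈) →
                (((cA , cB , tt) , tt) , ((fA , fB , tt) , tt)) ,
                mp-∈ u (mp-∈ u (thm-∈ u ∧-intro) A∈) B∈ })
           {A = ⊥ᶠ}
           (λ { {C} ((c , f) , C∈) □¬C →
                ⊥-∉ u (mp-∈ u (unbox sRu (preserve (∼-sym s∼t)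
                  (Local-□ i {¬ᶠ C} ((c , tt) , (f , tt))) □¬C)) C∈) })
  ... | v , tRv , ⊆v , _ = v , tRv , ∼-sym (agree λ l B∈ → ⊆v (l , B∈))

  -- Unlike `R i s w`, this depends only on the local theory of `s`.
  Admits : Fin 2 → World → World → Set
  Admits i s w = ∃[ v ] R i s v × v ∼[ i ] w

  Admits-resp-∼ : ∀ {i s t w} → s ∼[ i ] t → Admits i s w → Admits i t w
  Admits-resp-∼ s∼t (v , sRv , v∼w) =
    let v′ , tRv′ , v′∼v = ∼-successor s∼t sRv in v′ , tRv′ , ∼-trans v′∼v v∼w

  Path : Set
  Path = List (Maybe World)

  -- Trying `w` itself first lets a path reach a prescribed successor exactly.
  step : Fin 2 → World → Maybe World → World
  step i s nothing = s
  step i s (just w) with em {P = R i s w} | em {P = Admits i s w}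
  ... | yes _ | _           = w
  ... | no _  | yes (v , _) = v
  ... | no _  | no _        = s

  step-≡ : ∀ {i s w} → R i s w → step i s (just w) ≡ w
  step-≡ {i} {s} {w} sRw with em {P = R i s w}
  ... | yes _ = refl
  ... | no ¬R = ⊥-elim (¬R sRw)

  step-R : ∀ {i s w} → Admits i s w → R i s (step i s (just w))
  step-R {i} {s} {w} adm with em {P = R i s w} | em {P = Admits i s w}
  ... | yes sRw | _                 = sRw
  ... | no _    | yes (_ , sRv , _) = sRv
  ... | no _    | no ¬adm           = ⊥-elim (¬adm adm)

  step-admitted : ∀ {i s w} → Admits i s w → step i s (just w) ∼[ i ] w
  step-admitted {i} {s} {w} adm with em {P = R i s w} | em {P = Admits i s w}
  ... | yes _ | _                 = ∼-refl
  ... | no _  | yes (_ , _ , v∼w) = v∼w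
  ... | no _  | no ¬adm           = ⊥-elim (¬adm adm)

  step-stay : ∀ {i s w} → ¬ Admits i s w → step i s (just w) ≡ s
  step-stay {i} {s} {w} ¬adm with em {P = R i s w} | em {P = Admits i s w}
  ... | yes sRw | _       = ⊥-elim (¬adm (w , sRw , ∼-refl))
  ... | no _    | yes adm = ⊥-elim (¬adm adm)
  ... | no _    | no _    = refl

  -- Either both worlds admit `w`, and both results agree locally with `w`, or both stay.
  step-∼ : ∀ {i s t} m → s ∼[ i ] t → step i s m ∼[ i ] step i t m
  step-∼ nothing s∼t = s∼t
  step-∼ {i} {s} {t} (just w) s∼t = go em
    where
    go : Dec (Admits i s w) → step i s (just w) ∼[ i ] step i t (just w)
    go (yes adm) =
      ∼-trans (step-admitted adm) (∼-sym (step-admitted (Admits-resp-∼ s∼t adm)))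
    go (no ¬adm) = ∼-trans (∼-reflexive (step-stay ¬adm))
      (∼-trans s∼t (∼-reflexive (sym (step-stay (¬adm ∘ Admits-resp-∼ (∼-sym s∼t))))))

  step-opposite-∼ : ∀ i {s} m → s ∼[ i ] step (opposite i) s m
  step-opposite-∼ i nothing  = ∼-refl
  step-opposite-∼ i {s} (just w) = go em
    where
    go : Dec (Admits (opposite i) s w) → s ∼[ i ] step (opposite i) s (just w)
    go (yes adm) = R⇒∼ (step-R adm)
    go (no ¬adm) = ∼-reflexive (sym (step-stay ¬adm))

  run : Fin 2 → World → Path → World
  run i = foldl (step i)

  run-opposite-∼ : ∀ i {s} α → s ∼[ i ] run (opposite i) s α
  run-opposite-∼ i []      = ∼-refl
  run-opposite-∼ i (m ∷ α) = ∼-trans (step-opposite-∼ i m) (run-opposite-∼ i α)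

  run-∼ : ∀ {i s t} α → s ∼[ i ] t → run i s α ∼[ i ] run i t α
  run-∼ []      s∼t = s∼t
  run-∼ (m ∷ α) s∼t = run-∼ α (step-∼ m s∼t)

  run-pausing : ∀ {i s w} k → Admits i s w → R i s (run i s (pausing k w))
  run-pausing zero    adm = step-R adm
  run-pausing (suc k) adm = run-pausing k adm

  run-pausing-≡ : ∀ {i s w} k → R i s w → run i s (pausing k w) ≡ w
  run-pausing-≡ zero    = step-≡
  run-pausing-≡ (suc k) = run-pausing-≡ k

  -- Interleaving two paths

  merge : World → Path → Path → World
  -- A path that has run out counts as pausing forever.
  merge s []      β       = run (suc zero) s β
  merge s (a ∷ α) []      = run zero s (a ∷ α)
  merge s (a ∷ α) (b ∷ β) = merge (step (suc zero) (step zero s a) b) α β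

  -- When `δ` starts, at most `length β` moves of `β` remain, and its pauses outlast them.
  merge-++₁ : ∀ s α β δ → Delayed (length β) δ →
              merge s (α ++ δ) β ≡ run zero (merge s α β) δ
  merge-++₁ s []      []      []            _ = refl
  merge-++₁ s []      []      (m ∷ δ)       _ = refl
  merge-++₁ s []      (b ∷ β) []            _ = refl
  merge-++₁ s []      (b ∷ β) (nothing ∷ δ) d = merge-++₁ _ [] β δ d
  merge-++₁ s (a ∷ α) []      δ             _ = foldl-++ (step zero) s (a ∷ α) δ
  merge-++₁ s (a ∷ α) (b ∷ β) δ             d = merge-++₁ _ α β δ (Delayed-mono (n≤1+n _) δ d)

  merge-++₂ : ∀ s α β δ → Delayed (length α) δ →
              merge s α (β ++ δ) ≡ run (suc zero) (merge s α β) δ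
  merge-++₂ s []      β       δ             _ = foldl-++ (step (suc zero)) s β δ
  merge-++₂ s (a ∷ α) []      []            _ = refl
  merge-++₂ s (a ∷ α) []      (nothing ∷ δ) d =
    trans (merge-++₂ _ α [] δ d) (cong (λ u → run (suc zero) u δ) (lemma α))
    where
    lemma : ∀ {s} α → merge s α [] ≡ run zero s α
    lemma []      = refl
    lemma (_ ∷ _) = refl
  merge-++₂ s (a ∷ α) (b ∷ β) δ             d = merge-++₂ _ α β δ (Delayed-mono (n≤1+n _) δ d)

  -- Moves of the second factor preserve the `∼[ zero ]`-class. The start `t` varies because the two
  -- runs may drift apart within a class.
  merge-∼₁ : ∀ {s t} α β → s ∼[ zero ] t → merge s α β ∼[ zero ] run zero t α
  merge-∼₁ []      β       s∼t = ∼-trans (∼-sym (run-opposite-∼ zero β)) s∼t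
  merge-∼₁ (a ∷ α) []      s∼t = run-∼ (a ∷ α) s∼t
  merge-∼₁ (a ∷ α) (b ∷ β) s∼t = merge-∼₁ α β
    (∼-trans (∼-sym (step-opposite-∼ zero b)) (step-∼ a s∼t))

  merge-∼₂ : ∀ {s t} α β → s ∼[ suc zero ] t → merge s α β ∼[ suc zero ] run (suc zero) t β
  merge-∼₂ []      β       s∼t = run-∼ β s∼t
  merge-∼₂ (a ∷ α) []      s∼t = ∼-trans (∼-sym (run-opposite-∼ (suc zero) (a ∷ α))) s∼t
  merge-∼₂ (a ∷ α) (b ∷ β) s∼t = merge-∼₂ α β
    (step-∼ b (∼-trans (∼-sym (step-opposite-∼ (suc zero) a)) s∼t))

-- The frames of paths and the truth lemma

module Completeness (em : ∀ {a} → ExcludedMiddle a)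
                    {L : Pred (Form 2) 0ℓ} (isLogic : IsLogic L) (Δ⊆L : Δ ⊆ L)
                    (ℓ : Level) (s₀ : Canonical.World em isLogic) where
  open Canonical em isLogic
  open Paths em isLogic Δ⊆L
  private module L = IsLogic isLogic

  -- Quantifying over all worlds t that agree with the end of x, rather than
  -- taking only that end, makes the relation transfer along the other factor.
  record Near (i : Fin 2) (k : ℕ) (x y : Lift ℓ Path) : Set ℓ where
    constructor near
    field
      δ       : Path
      y≡      : lower y ≡ lower x ++ δ
      delayed : Delayed k δ
      uniform : ∀ {t} → run i s₀ (lower x) ∼[ i ] t → R i t (run i t δ)

  Near-mono : ∀ {i k k′ x} → k ≤ k′ → Near i k′ x ⊆ Near i k x
  Near-mono k≤ (near δ eq d u) = near δ eq (Delayed-mono k≤ δ d) u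

  frame : Fin 2 → NFrame 1 ℓ
  frame i = record
    { Carrier  = Lift ℓ Path
    ; nonempty = lift []
    -- If the end of `x` has no `R i`-successor, `Near i k x` is empty and every set is a
    -- neighbourhood.
    ; τ        = λ _ x V → Lift (lsuc ℓ) (∃[ k ] Near i k x ⊆ V)
    ; filter   = λ _ x → record
      { whole = lift (0 , _)
      ; inter = λ (lift (k , V⊇)) (lift (k′ , W⊇)) → lift (k ⊔ k′ , λ y →
          V⊇ (Near-mono (m≤m⊔n k k′) y) , W⊇ (Near-mono (m≤n⊔m k k′) y))
      ; upper = λ V⊆W (lift (k , V⊇)) → lift (k , λ y → V⊆W (V⊇ y))
      }
    }

  open ProductTruth frame

  path : Fin 2 → Point → Path
  path i z = lower (coord i z)

  state : Point → World
  state (x , y) = merge s₀ (lower x) (lower y)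

  extend : ∀ i → Path → Point → Point
  extend i δ z = put i (lift (path i z ++ δ)) z

  state-extend : ∀ i z δ → Delayed (length (path (opposite i) z)) δ →
                 state (extend i δ z) ≡ run i (state z) δ
  state-extend zero       (lift α , lift β) δ d = merge-++₁ s₀ α β δ d
  state-extend (suc zero) (lift α , lift β) δ d = merge-++₂ s₀ α β δ d

  state-∼ : ∀ i z → state z ∼[ i ] run i s₀ (path i z)
  state-∼ zero       (lift α , lift β) = merge-∼₁ α β ∼-refl
  state-∼ (suc zero) (lift α , lift β) = merge-∼₂ α β ∼-refl

  θ₀ : ℕ → Pred Point ℓ
  θ₀ p z = Lift ℓ (var p ∈ʷ state z)

  mutual
    truth⁺ : ∀ A z → A ∈ʷ state z → Truth 𝔓 θ₀ A z
    truth⁺ (var p) z A∈ = lift (lift A∈)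
    truth⁺ ⊥ᶠ      z A∈ = lift (⊥-∉ (state z) A∈)
    truth⁺ (A ⇒ B) z A∈ = λ t → truth⁺ B z (mp-∈ (state z) A∈ (truth⁻ A z t))
    -- This delay lets the other path finish first.
    truth⁺ (□ i A) z A∈ = □⁺ i z (lift (length (path (opposite i) z) , id)) go
      where
      go : ∀ {y} → Near i (length (path (opposite i) z)) (coord i z) y →
           Truth 𝔓 θ₀ A (put i y z)
      go {lift _} (near δ refl d u) =
        truth⁺ A _ (≡-subst (A ∈ʷ_) (sym (state-extend i z δ d))
          -- Uniformity is used at `state z`, which may differ from the end of the path but agrees
          -- with it locally.
          (unbox (u (∼-sym (state-∼ i z))) A∈))

    truth⁻ : ∀ A z → Truth 𝔓 θ₀ A z → A ∈ʷ state z
    truth⁻ (var p) z (lift (lift A∈)) = A∈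
    truth⁻ ⊥ᶠ      z (lift ())
    truth⁻ (A ⇒ B) z t = ⇒-∈ (state z) (truth⁻ B z ∘ t ∘ truth⁺ A z)
    truth⁻ (□ i A) z t with □ i A ∈ʷ? state z
    ... | yes A∈ = A∈
    ... | no A∉ with □-successor (state z) A∉ | □⁻ i z t
    ... | u , sRu , A∉u | V , lift (k , V⊇) , ⊨A =
      ⊥-elim (A∉u (≡-subst (A ∈ʷ_) state≡ (truth⁻ A _ (⊨A (V⊇ close)))))
      where
      -- The bound `k` puts the extension into `V`; the length makes it act on `state z`.
      K′ = k ⊔ length (path (opposite i) z)
      δ = pausing K′ u

      state≡ : state (extend i δ z) ≡ u
      state≡ = trans
        (state-extend i z δ (Delayed-mono (m≤n⊔m k _) δ (Delayed-pausing K′)))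
        (run-pausing-≡ K′ sRu)

      close : Near i k (coord i z) (lift (path i z ++ δ))
      close =
        near δ refl (Delayed-mono (m≤m⊔n k _) δ (Delayed-pausing K′))
          -- `state z` admits `u`, hence so does every world locally equivalent to it.
          (λ t∼ → run-pausing K′ (Admits-resp-∼ (∼-trans (state-∼ i z) t∼) (u , sRu , ∼-refl)))

  origin : Point
  origin = lift [] , lift []

  complete : ∀ {A} → Valid 𝔓 A → A ∈ʷ s₀
  complete ⊨A = truth⁻ _ origin (⊨A θ₀ origin)

  -- A theorem lies in every world, so it is true under `θ₀`; for a closed formula the valuation is
  -- immaterial.
  closed-valid : ∀ i {A} → Closed A → embed i A ∈ L → Valid (frame i) A
  closed-valid i {A} c A∈L θ x = Closed-Truth A c
    (embed⁻ i A {z = origin} (truth⁺ (embed i A) _ (thm-∈ (state (put i x origin)) A∈L)))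

  -- By the axiom, `m` consecutive `R i`-steps amount to one, so the composite extension already
  -- lies in the neighbourhood given by the premise.
  □⇒□^-valid : ∀ i p m → embed i (□ zero (var p) ⇒ □^ m (var p)) ∈ L →
               Valid (frame i) (□ zero (var p) ⇒ □^ m (var p))
  □⇒□^-valid i p m □⇒□^∈L θ (lift α) (V , lift (k , V⊇) , V⊆p) =
    -- The empty extension counts as delayed by any `k`; this also settles `m = 0`.
    go m (lift α) [] (sym (++-identityʳ α)) (Delayed-[] k) (λ {t} _ □A → axiom t □A)
    where
    axiom : ∀ {A} w → □ i A ∈ʷ w → boxes i m A ∈ʷ w
    axiom {A} w = mp-∈ w (thm-∈ w (≡-subst (λ B → (□ i A ⇒ B) ∈ L)
      (subst-embed-□^ i m (λ _ → A)) (L.sub (λ _ → A) □⇒□^∈L)))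

    -- Invariant with `r` steps left: whatever is boxed at `t` holds under `r` boxes after `δ`.
    go : ∀ r y δ → lower y ≡ α ++ δ → Delayed k δ →
         (∀ {t} → run i s₀ α ∼[ i ] t → ∀ {A} → □ i A ∈ʷ t → boxes i r A ∈ʷ run i t δ) →
         Truth (frame i) θ (□^ r (var p)) y
    -- With no steps left the invariant says that `δ` as a whole is a single `R i`-step.
    go zero    y δ eq d u = V⊆p (V⊇ (near δ eq d (λ t∼ → related (u t∼))))
    go (suc r) y δ eq d u = _ , lift (k , id) , λ { {y′} (near δ′ eq′ d′ u′) →
      go r y′ (δ ++ δ′) (trans eq′ (trans (cong (_++ δ′) eq) (++-assoc α δ δ′)))
        (Delayed-++ k δ δ′ d d′)
        (λ {t} t∼ {A} □A → ≡-subst (boxes i r A ∈ʷ_) (sym (foldl-++ (step i) t δ δ′))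
          (unbox (u′ (∼-trans
             (∼-reflexive (trans (cong (run i s₀) eq) (foldl-++ (step i) s₀ α δ)))
             (run-∼ δ t∼)))
           (u t∼ □A))) }

  -- `M` is generated by its axioms, and the embedding of each lies in `L`.
  frame-nV : ∀ i {M} → IsHTC M → Embed i M ⊆ L → nV ℓ M (frame i)
  frame-nV i {M} (Γ , Γ⊆HTC , M⊆K+Γ , K+Γ⊆M) embed⊆L A∈M =
    Least-minimal isLogic′ K∪Γ-valid (M⊆K+Γ A∈M)
    where
    isLogic′ : IsLogic (Valid (frame i))
    isLogic′ = Soundness.Valid-isLogic em (frame i)

    HTC-valid : ∀ {A} → HTCAxiom A → A ∈ M → Valid (frame i) A
    HTC-valid (closed c)  A∈ = closed-valid i c (embed⊆L (embedded A∈))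
    HTC-valid (□⇒□^ p k) A∈ = □⇒□^-valid i p k (embed⊆L (embedded A∈))

    K∪Γ-valid : (K 1 ∪ Γ) ⊆ Valid (frame i)
    K∪Γ-valid (inj₁ A∈K) = Least-minimal isLogic′ (λ ()) A∈K
    K∪Γ-valid (inj₂ A∈Γ) = HTC-valid (Γ⊆HTC A∈Γ) (K+Γ⊆M (ax (inj₂ A∈Γ)))

-- Both inclusions

factors : NFrame n ℓ → NFrame n ℓ → Fin 2 → NFrame n ℓ
factors 𝔛₁ 𝔛₂ zero       = 𝔛₁
factors 𝔛₁ 𝔛₂ (suc zero) = 𝔛₂

module _ {L₁ L₂ : Pred (Form 1) 0ℓ} where

  Embed₁⊆ : Embed zero L₁ ⊆ ⟨ L₁ , L₂ ⟩
  Embed₁⊆ A∈ = ax (inj₁ (ax (inj₁ (ax (inj₂ A∈)))))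

  Embed₂⊆ : Embed (suc zero) L₂ ⊆ ⟨ L₁ , L₂ ⟩
  Embed₂⊆ A∈ = ax (inj₁ (ax (inj₂ A∈)))

  module _ (em : ∀ {a} → ExcludedMiddle a) (ℓ : Level) where

    product-sound : ⟨ L₁ , L₂ ⟩ ⊆ L₁ ×ₙ[ ℓ ] L₂
    product-sound A∈ _ (product {𝔛₁} {𝔛₂} ⊨L₁ ⊨L₂) =
      Least-minimal isLogic
        (λ { (inj₁ A∈) → Least-minimal isLogic
             (λ { (inj₁ A∈) → Least-minimal isLogic
                  (λ { (inj₁ A∈) → Least-minimal isLogic (λ ()) A∈
                     ; (inj₂ (embedded {A} A∈)) → embed-valid zero A (⊨L₁ A∈) }) A∈
                ; (inj₂ (embedded {A} A∈)) → embed-valid (suc zero) A (⊨L₂ A∈) }) A∈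
           ; (inj₂ A∈) → Δ-valid A∈ }) A∈
      where
      open ProductTruth (factors 𝔛₁ 𝔛₂)

      isLogic : IsLogic (Valid (𝔛₁ ⊗ 𝔛₂))
      isLogic = Soundness.Valid-isLogic em (𝔛₁ ⊗ 𝔛₂)

    product-complete : IsHTC L₁ → IsHTC L₂ → L₁ ×ₙ[ ℓ ] L₂ ⊆ ⟨ L₁ , L₂ ⟩
    product-complete htc₁ htc₂ {A} ⊨A with em {P = A ∈ ⟨ L₁ , L₂ ⟩}
    ... | yes A∈ = A∈
    ... | no  A∉ = let s₀ , _ , A∉s₀ = lindenbaum {Γ = ∅} (A∉ ∘ ∅⊢⇒∈)
                   in ⊥-elim (A∉s₀ (valid⇒∈ s₀))
      where
      isLogic : IsLogic ⟨ L₁ , L₂ ⟩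
      isLogic = Least-isLogic _

      open Canonical em isLogic

      ∅⊢⇒∈ : ∀ {B} → ∅ ⊢ B → B ∈ ⟨ L₁ , L₂ ⟩
      ∅⊢⇒∈ (thm B∈)  = B∈
      ∅⊢⇒∈ (mp d e) = mp (∅⊢⇒∈ d) (∅⊢⇒∈ e)

      valid⇒∈ : ∀ s₀ → A ∈ʷ s₀
      valid⇒∈ s₀ = complete
        (⊨A _ (product (frame-nV zero htc₁ Embed₁⊆) (frame-nV (suc zero) htc₂ Embed₂⊆)))
        where open Completeness em isLogic (ax ∘ inj₂) ℓ s₀

theorem7p12 : (∀ {a} → ExcludedMiddle a) →
    (ℓ : Level) (L₁ L₂ : Pred (Form 1) 0ℓ) →
    IsHTC L₁ → IsHTC L₂ →
    Satisfiable (nV ℓ L₁) → Satisfiable (nV ℓ L₂) →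
    (L₁ ×ₙ[ ℓ ] L₂) ≐ ⟨ L₁ , L₂ ⟩
theorem7p12 em ℓ L₁ L₂ htc₁ htc₂ _ _ =
  product-complete em ℓ htc₁ htc₂ , product-sound em ℓ
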